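{- Let $\alpha$ be an infinite ordinal and let $E$ be a set of equations in the language of $\mathsf{CA}_\alpha$. Then $E$ is inductive if and only if $E=\mathsf{Eq}(\mathsf K)$ for some $\mathsf K\subseteq\mathsf{Lf}_\alpha$.
   Context: A cylindric algebra of dimension $\alpha$ (a $\mathsf{CA}_\alpha$) is an algebra $\langle A,+,-,c_i,d_{ij}: i,j\in\alpha\rangle$ satisfying the cylindric axioms: $\langle A,+,-\rangle$ is a Boolean algebra and for all distinct $i,j,k\in\alpha$: $c_ic_jx=c_jc_ix$, $x\le c_ix=c_ic_ix$, $c_i(x+y)=c_ix+c_iy$, $c_i-c_ix=-c_ix$, $d_{ii}=1$, $d_{ij}=d_{ji}$, $c_j(d_{ij}\cdot d_{jk})=d_{ik}$, $c_id_{ij}=1$, $d_{ij}\cdot c_i(d_{ij}\cdot x)=d_{ij}\cdot x$. $\mathsf{Lf}_\alpha$ is the class of those $\mathsf{CA}_\alpha$s in which for each element $x$ we have $c_ix=x$ for all but finitely many $i\in\alpha$. Equations use a fixed countably infinite set of variables; $\mathsf{Eq}(\mathsf K)$ is the set of all equations valid in all members of $\mathsf K$. An index $i\in\alpha$ occurs in an equation if $c_i$, or some $d_{ij}$ or $d_{ji}$, occurs in it. A set $E$ of equations in the language of $\mathsf{CA}_\alpha$ is inductive if it contains the cylindric axioms axiomatizing $\mathsf{CA}_\alpha$, it is semantically closed (i.e. $e\in E$ iff $E\models e$, for every equation $e$), and $e(c_ix_1,\dots,c_ix_n)\in E$ implies $e(x_1,\dots,x_n)\in E$ whenever $e$ is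 an equation (with variables $x_1,\dots,x_n$) and $i\in\alpha$ does not occur as an index of an operation in $e$. -}

module Defs where

open import Level using (Level; suc; _⊔_)
open import Algebra.Core using (Op₁; Op₂)
open import Algebra.Definitions using (Congruent₁; Congruent₂)
open import Algebra.Lattice.Structures using (IsBooleanAlgebra)
open import Algebra.Lattice.Structures.Biased using (isBooleanAlgebraʳ; isDistributiveLatticeʳʲᵐ)
open import Data.List.Membership.Propositional using (_∉_)
open import Data.Nat.Base using (ℕ)
open import Data.Product.Base using (_×_; _,_; ∃-syntax)
open import Data.Sum.Base using (_⊎_)
open import Function.Bundles using (_⇔_; _↣_)
open import Induction.WellFounded using (WellFounded)
open import Relation.Binary.Core using (Rel)
open import Relation.Binary.Structures using (IsEquivalence; IsStrictTotalOrder)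
open import Relation.Binary.PropositionalEquality using (_≡_; _≢_)
open import Relation.Nullary.Negation.Core using (¬_)
open import Relation.Unary using (Pred; _∈_; _⊆_)

private
  variable
    a ℓ : Level
    I : Set a

-- An ordinal is presented by its set of elements with the membership order,
-- that is, as a strictly well-ordered set.
record Ordinal (a : Level) : Set (suc a) where
  infix 4 _<_
  field
    Index              : Set a
    _<_                : Rel Index a
    isStrictTotalOrder : IsStrictTotalOrder _≡_ _<_
    wellFounded        : WellFounded _<_

open Ordinal public using (Index)

-- For a well-ordered set, being infinite is the same as containing a copy
-- of ω.
Infinite : Ordinal a → Set a
Infinite α = ℕ ↣ Index α

infixl 6 _⊕_
infixl 7 _⊙_
infix  8 ⊖_
infix  4 _≋_

data Term (I : Set a) : Set a where
  var  : ℕ → Term I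
  _⊕_  : Term I → Term I → Term I
  ⊖_   : Term I → Term I
  cyl  : I → Term I → Term I
  diag : I → I → Term I

-- Meet and unit are not in the signature ⟨+, -, cᵢ, dᵢⱼ⟩.  The unit is
-- x + -x for a fixed variable x; the complement law among the axioms below
-- makes it independent of x.
_⊙_ : Term I → Term I → Term I
s ⊙ t = ⊖ (⊖ s ⊕ ⊖ t)

𝟏 : Term I
𝟏 = var 0 ⊕ ⊖ var 0

record Equation (I : Set a) : Set a where
  constructor _≋_
  field
    lhs rhs : Term I

data _occursInTerm_ {I : Set a} (i : I) : Term I → Set a where
  in-⊕ˡ    : ∀ {s t} → i occursInTerm s → i occursInTerm (s ⊕ t)
  in-⊕ʳ    : ∀ {s t} → i occursInTerm t → i occursInTerm (s ⊕ t)
  in-⊖     : ∀ {t} → i occursInTerm t → i occursInTerm (⊖ t)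
  at-cyl   : ∀ {t} → i occursInTerm (cyl i t)
  in-cyl   : ∀ {j t} → i occursInTerm t → i occursInTerm (cyl j t)
  at-diagˡ : ∀ {j} → i occursInTerm (diag i j)
  at-diagʳ : ∀ {j} → i occursInTerm (diag j i)

_occursIn_ : {I : Set a} → I → Equation I → Set a
i occursIn (s ≋ t) = i occursInTerm s ⊎ i occursInTerm t

substTerm : (ℕ → Term I) → Term I → Term I
substTerm σ (var n)    = σ n
substTerm σ (s ⊕ t)    = substTerm σ s ⊕ substTerm σ t
substTerm σ (⊖ t)      = ⊖ substTerm σ t
substTerm σ (cyl i t)  = cyl i (substTerm σ t)
substTerm σ (diag i j) = diag i j

substEquation : (ℕ → Term I) → Equation I → Equation I
substEquation σ (s ≋ t) = substTerm σ s ≋ substTerm σ t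

-- e(x₁,…,xₙ) ↦ e(cᵢx₁,…,cᵢxₙ)
cylindrifyVars : I → Equation I → Equation I
cylindrifyVars i = substEquation (λ n → cyl i (var n))

-- Algebras of the similarity type of cylindric algebras.  Equality is a
-- setoid equality, so that quotients exist; no axioms are imposed here.
record Algebra {a} (I : Set a) : Set (suc a) where
  infix  4 _≈_
  infixl 6 _+_
  infix  8 -_
  field
    Carrier       : Set a
    _≈_           : Rel Carrier a
    isEquivalence : IsEquivalence _≈_
    _+_           : Op₂ Carrier
    -_            : Op₁ Carrier
    c             : I → Op₁ Carrier
    d             : I → I → Carrier
    +-cong        : Congruent₂ _≈_ _+_
    -‿cong        : Congruent₁ _≈_ -_
    c-cong        : ∀ i → Congruent₁ _≈_ (c i)

  infixl 7 _·_
  _·_ : Op₂ Carrier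
  x · y = - (- x + - y)

  ⟦_⟧ : Term I → (ℕ → Carrier) → Carrier
  ⟦ var n ⟧ ρ    = ρ n
  ⟦ s ⊕ t ⟧ ρ    = ⟦ s ⟧ ρ + ⟦ t ⟧ ρ
  ⟦ ⊖ t ⟧ ρ      = - ⟦ t ⟧ ρ
  ⟦ cyl i t ⟧ ρ  = c i (⟦ t ⟧ ρ)
  ⟦ diag i j ⟧ ρ = d i j

infix 4 _⊨_ _⊨*_ _⊩_

_⊨_ : {I : Set a} → Algebra I → Equation I → Set a
A ⊨ (s ≋ t) = ∀ ρ → ⟦ s ⟧ ρ ≈ ⟦ t ⟧ ρ
  where open Algebra A

_⊨*_ : {I : Set a} → Algebra I → Pred (Equation I) ℓ → Set (a ⊔ ℓ)
A ⊨* E = ∀ e → e ∈ E → A ⊨ e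

_⊩_ : {I : Set a} → Pred (Equation I) ℓ → Equation I → Set (suc a ⊔ ℓ)
E ⊩ e = ∀ A → A ⊨* E → A ⊨ e

Eq : {I : Set a} → Pred (Algebra I) ℓ → Pred (Equation I) (suc a ⊔ ℓ)
Eq K e = ∀ A → A ∈ K → A ⊨ e

-- The first nine constructors say that ⟨A, +, -⟩ is a Boolean algebra; see
-- isBooleanAlgebra below.
data CylindricAxiom {I : Set a} : Pred (Equation I) a where
  +-comm : CylindricAxiom (var 0 ⊕ var 1 ≋ var 1 ⊕ var 0)
  +-assoc : CylindricAxiom ((var 0 ⊕ var 1) ⊕ var 2 ≋ var 0 ⊕ (var 1 ⊕ var 2))
  ·-comm : CylindricAxiom (var 0 ⊙ var 1 ≋ var 1 ⊙ var 0)
  ·-assoc : CylindricAxiom ((var 0 ⊙ var 1) ⊙ var 2 ≋ var 0 ⊙ (var 1 ⊙ var 2))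
  +-absorbs-· : CylindricAxiom (var 0 ⊕ (var 0 ⊙ var 1) ≋ var 0)
  ·-absorbs-+ : CylindricAxiom (var 0 ⊙ (var 0 ⊕ var 1) ≋ var 0)
  +-distribʳ-· : CylindricAxiom ((var 1 ⊙ var 2) ⊕ var 0 ≋ (var 1 ⊕ var 0) ⊙ (var 2 ⊕ var 0))
  +-complementʳ : CylindricAxiom (var 1 ⊕ ⊖ var 1 ≋ 𝟏)
  ·-complementʳ : CylindricAxiom (var 1 ⊙ ⊖ var 1 ≋ ⊖ 𝟏)
  c-comm : ∀ {i j} → i ≢ j → CylindricAxiom (cyl i (cyl j (var 0)) ≋ cyl j (cyl i (var 0)))
  -- x ≤ y is the equation x + y = y
  c-increasing : ∀ {i} → CylindricAxiom (var 0 ⊕ cyl i (var 0) ≋ cyl i (var 0))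
  c-idem : ∀ {i} → CylindricAxiom (cyl i (var 0) ≋ cyl i (cyl i (var 0)))
  c-distrib-+ : ∀ {i} → CylindricAxiom (cyl i (var 0 ⊕ var 1) ≋ cyl i (var 0) ⊕ cyl i (var 1))
  c-complement : ∀ {i} → CylindricAxiom (cyl i (⊖ cyl i (var 0)) ≋ ⊖ cyl i (var 0))
  d-refl : ∀ {i} → CylindricAxiom (diag i i ≋ 𝟏)
  d-sym : ∀ {i j} → i ≢ j → CylindricAxiom (diag i j ≋ diag j i)
  d-trans : ∀ {i j k} → i ≢ j → j ≢ k → i ≢ k →
            CylindricAxiom (cyl j (diag i j ⊙ diag j k) ≋ diag i k)
  c-d : ∀ {i j} → i ≢ j → CylindricAxiom (cyl i (diag i j) ≋ 𝟏)
  d-c : ∀ {i j} → i ≢ j →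
        CylindricAxiom (diag i j ⊙ cyl i (diag i j ⊙ var 0) ≋ diag i j ⊙ var 0)

CA : {I : Set a} → Pred (Algebra I) a
CA A = A ⊨* CylindricAxiom

isBooleanAlgebra : {I : Set a} (A : Algebra I) → A ∈ CA →
                   let open Algebra A in
                   ∀ x → IsBooleanAlgebra _≈_ _+_ _·_ -_ (x + - x) (- (x + - x))
isBooleanAlgebra A ca x₀ = isBooleanAlgebraʳ record
  { isDistributiveLattice = isDistributiveLatticeʳʲᵐ record
    { isLattice = record
      { isEquivalence = isEquivalence
      ; ∨-comm        = λ x y → ca _ +-comm (val x y y)
      ; ∨-assoc       = λ x y z → ca _ +-assoc (val x y z)
      ; ∨-cong        = +-cong
      ; ∧-comm        = λ x y → ca _ ·-comm (val x y y)
      ; ∧-assoc       = λ x y z → ca _ ·-assoc (val x y z)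
      ; ∧-cong        = λ p q → -‿cong (+-cong (-‿cong p) (-‿cong q))
      ; absorptive    = (λ x y → ca _ +-absorbs-· (val x y y))
                      , (λ x y → ca _ ·-absorbs-+ (val x y y))
      }
    ; ∨-distribʳ-∧ = λ x y z → ca _ +-distribʳ-· (val x y z)
    }
  ; ∨-complementʳ = λ x → ca _ +-complementʳ (val x₀ x x)
  ; ∧-complementʳ = λ x → ca _ ·-complementʳ (val x₀ x x)
  ; ¬-cong        = -‿cong
  }
  where
  open Algebra A
  val : Carrier → Carrier → Carrier → ℕ → Carrier
  val x y z 0 = x
  val x y z 1 = y
  val x y z _ = z

Lf : {I : Set a} → Pred (Algebra I) a
Lf {I = I} A = A ∈ CA × (∀ x → ∃[ is ] (∀ (i : I) → i ∉ is → c i x ≈ x))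
  where open Algebra A

record Inductive {a} {I : Set a} (E : Pred (Equation I) a) : Set (suc a) where
  field
    containsAxioms     : CylindricAxiom ⊆ E
    semanticallyClosed : ∀ e → e ∈ E ⇔ E ⊩ e
    decylindrify       : ∀ e i → ¬ (i occursIn e) → cylindrifyVars i e ∈ E → e ∈ E

{-# OPTIONS --safe #-}

-- An algebra in Lfα passes from e(cᵢx) to e(x) for i not in e: given
-- elements, pick j outside e and outside all their supports.  The substitution
-- sⁱⱼ x = cᵢ(dᵢⱼ · x) is then a homomorphism for the operations of e, takes
-- values fixed by cᵢ, and is injective on the elements fixed by cⱼ because
-- sʲᵢ inverts it there.
--
-- Conversely, for an inductive E and an equation e, consider the algebra of
-- terms in which s and t are identified when E contains s ≋ t with c_Δ x
-- substituted for every variable x, for some finite set Δ of indices foreign to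
-- e.  It is a model of E in Lfα, and if e holds in it then e(c_Δ x) ∈ E, so that
-- e ∈ E after stripping the indices of Δ one at a time.

module Submission where

open import Defs
open import Level using (suc; Lift; lift; lower)
open import Algebra.Lattice.Bundles using (BooleanAlgebra)
import Algebra.Lattice.Properties.BooleanAlgebra as BooleanAlgebraProperties
open import Data.Fin.Base using (Fin; toℕ)
open import Data.Fin.Properties using (pigeonhole; ¬∀⟶∃¬; toℕ-injective; <⇒≢)
open import Data.List.Base using (List; []; _∷_; _++_; length; lookup)
open import Data.List.Membership.Propositional using (_∉_) renaming (_∈_ to _∈ₗ_)
open import Data.List.Membership.Propositional.Properties using (∈-++⁺ˡ; ∈-++⁺ʳ; ∈-++⁻)
import Data.List.Membership.DecPropositional as DecMembership
open import Data.List.Relation.Unary.Any using (here; there; index)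
open import Data.List.Relation.Unary.Any.Properties using (lookup-index)
open import Data.Nat.Base using (ℕ)
open import Data.Nat.Properties using (n<1+n)
open import Data.Product.Base using (_×_; _,_; proj₁; proj₂; ∃-syntax)
open import Data.Sum.Base using (_⊎_; inj₁; inj₂; [_,_]; map₁)
open import Function.Base using (_∘_)
open import Function.Bundles using (_⇔_; _↣_; mk⇔; module Injection; module Equivalence)
open import Relation.Binary.Definitions using (DecidableEquality)
open import Relation.Binary.Structures using (IsEquivalence; IsStrictTotalOrder)
open import Relation.Binary.PropositionalEquality
  using (_≡_; _≢_; refl; sym; trans; cong; cong₂; subst₂; ≢-sym)
import Relation.Binary.Reasoning.Setoid as SetoidReasoning
open import Relation.Nullary using (Dec; ¬_; yes; no)
open import Relation.Unary using (Pred; _∈_; _⊆_; _≐_)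

-- Pigeonhole: the first `length is + 1` values of the injection cannot all lie in `is`, since two
-- of them would share a position. Decidable membership turns this into an actual missed value.
fresh : ∀ {a} {I : Set a} → DecidableEquality I → ℕ ↣ I →
        (is : List I) → ∃[ j ] j ∉ is
fresh {I = I} _≟_ ι is = f (proj₁ missed) , proj₂ missed
  where
  open DecMembership _≟_ using (_∈?_)
  open Injection ι using (to; injective)

  f : Fin (ℕ.suc (length is)) → I
  f = to ∘ toℕ

  not-all : ¬ (∀ k → f k ∈ₗ is)
  not-all f∈is with pigeonhole (n<1+n _) (λ k → index (f∈is k))
  ... | k , l , k<l , same =
    <⇒≢ k<l (toℕ-injective (injective (trans (lookup-index (f∈is k))
      (trans (cong (lookup is) same) (sym (lookup-index (f∈is l)))))))

  missed : ∃[ k ] f k ∉ is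
  missed = ¬∀⟶∃¬ _ _ (λ k → f k ∈? is) not-all

-- Indices of terms, substitution and evaluation.

module _ {a} {I : Set a} where

  -- Bounds both the indices occurring in a term and those its value may depend on, when `s n`
  -- bounds the latter for variable `n`. With `s` constantly empty it lists the occurring indices.
  support : (ℕ → List I) → Term I → List I
  support s (var n)    = s n
  support s (t ⊕ u)    = support s t ++ support s u
  support s (⊖ t)      = support s t
  support s (cyl i t)  = i ∷ support s t
  support s (diag i j) = i ∷ j ∷ []

  occurs⇒∈support : ∀ s {i t} → i occursInTerm t → i ∈ₗ support s t
  occurs⇒∈support s (in-⊕ˡ o)         = ∈-++⁺ˡ (occurs⇒∈support s o)
  occurs⇒∈support s (in-⊕ʳ {s = t} o) = ∈-++⁺ʳ (support s t) (occurs⇒∈support s o)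
  occurs⇒∈support s (in-⊖ o)          = occurs⇒∈support s o
  occurs⇒∈support s at-cyl            = here refl
  occurs⇒∈support s (in-cyl o)        = there (occurs⇒∈support s o)
  occurs⇒∈support s at-diagˡ          = here refl
  occurs⇒∈support s at-diagʳ          = there (here refl)

  occurs-substTerm : ∀ (σ : ℕ → Term I) t {i} → i occursInTerm substTerm σ t →
                     i occursInTerm t ⊎ ∃[ n ] i occursInTerm σ n
  occurs-substTerm σ (var n)    o          = inj₂ (n , o)
  occurs-substTerm σ (t ⊕ u)    (in-⊕ˡ o)  = map₁ in-⊕ˡ (occurs-substTerm σ t o)
  occurs-substTerm σ (t ⊕ u)    (in-⊕ʳ o)  = map₁ in-⊕ʳ (occurs-substTerm σ u o)
  occurs-substTerm σ (⊖ t)      (in-⊖ o)   = map₁ in-⊖ (occurs-substTerm σ t o)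
  occurs-substTerm σ (cyl i t)  at-cyl     = inj₁ at-cyl
  occurs-substTerm σ (cyl i t)  (in-cyl o) = map₁ in-cyl (occurs-substTerm σ t o)
  occurs-substTerm σ (diag i j) at-diagˡ   = inj₁ at-diagˡ
  occurs-substTerm σ (diag i j) at-diagʳ   = inj₁ at-diagʳ

  cyls : List I → Term I → Term I
  cyls []      t = t
  cyls (i ∷ Δ) t = cyl i (cyls Δ t)

  occurs-cyls : ∀ Δ {n i} → i occursInTerm cyls Δ (var n) → i ∈ₗ Δ
  occurs-cyls (i ∷ Δ) at-cyl     = here refl
  occurs-cyls (i ∷ Δ) (in-cyl o) = there (occurs-cyls Δ o)

  cylindrifyVarsBy : List I → Equation I → Equation I
  cylindrifyVarsBy Δ = substEquation (λ n → cyls Δ (var n))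

module Evaluation {a} {I : Set a} (A : Algebra I) where
  open Algebra A

  ⟦substTerm⟧ : ∀ σ ρ t → ⟦ substTerm σ t ⟧ ρ ≡ ⟦ t ⟧ (λ n → ⟦ σ n ⟧ ρ)
  ⟦substTerm⟧ σ ρ (var n)    = refl
  ⟦substTerm⟧ σ ρ (s ⊕ t)    = cong₂ _+_ (⟦substTerm⟧ σ ρ s) (⟦substTerm⟧ σ ρ t)
  ⟦substTerm⟧ σ ρ (⊖ t)      = cong -_ (⟦substTerm⟧ σ ρ t)
  ⟦substTerm⟧ σ ρ (cyl i t)  = cong (c i) (⟦substTerm⟧ σ ρ t)
  ⟦substTerm⟧ σ ρ (diag i j) = refl

  ⟦⟧-cong : ∀ {ρ ρ′} → (∀ n → ρ n ≈ ρ′ n) → ∀ t → ⟦ t ⟧ ρ ≈ ⟦ t ⟧ ρ′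
  ⟦⟧-cong ρ≈ρ′ (var n)    = ρ≈ρ′ n
  ⟦⟧-cong ρ≈ρ′ (s ⊕ t)    = +-cong (⟦⟧-cong ρ≈ρ′ s) (⟦⟧-cong ρ≈ρ′ t)
  ⟦⟧-cong ρ≈ρ′ (⊖ t)      = -‿cong (⟦⟧-cong ρ≈ρ′ t)
  ⟦⟧-cong ρ≈ρ′ (cyl i t)  = c-cong i (⟦⟧-cong ρ≈ρ′ t)
  ⟦⟧-cong ρ≈ρ′ (diag i j) = IsEquivalence.refl isEquivalence

  Fixed : I → Carrier → Set a
  Fixed i x = c i x ≈ x

  EqualUnder : (ℕ → Carrier) → Term I → Term I → Set a
  EqualUnder ρ t u = ⟦ t ⟧ ρ ≈ ⟦ u ⟧ ρ

-- Cylindric arithmetic: elements fixed by a cylindrification.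

-- The index o only serves to name an element of A.
module Cylindric {a} {I : Set a} (_≟_ : DecidableEquality I) (o : I)
                 (A : Algebra I) (ca : A ∈ CA) where
  open Algebra A
  open Evaluation A

  booleanAlgebra : BooleanAlgebra a a
  booleanAlgebra = record { isBooleanAlgebra = isBooleanAlgebra A ca (d o o) }

  open BooleanAlgebra booleanAlgebra using (⊤; ⊥; setoid)
  open BooleanAlgebra booleanAlgebra public using () renaming
    ( refl to ≈-refl; sym to ≈-sym; trans to ≈-trans
    ; ∧-cong to ·-cong; ∧-comm to ·-comm′; ∧-assoc to ·-assoc′
    ; ∨-comm to +-comm′
    ; ∨-absorbs-∧ to +-absorbs; ∧-absorbs-∨ to ·-absorbs
    ; ∧-distribˡ-∨ to ·-distribˡ-+; ∧-distribʳ-∨ to ·-distribʳ-+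
    ; ∨-complementʳ to +-compl; ∧-complementʳ to ·-compl; ∧-complementˡ to ·-complˡ)
  open BooleanAlgebraProperties booleanAlgebra public using () renaming
    ( ∧-identityʳ to ·-identityʳ; ∧-identityˡ to ·-identityˡ
    ; ∨-identityʳ to +-identityʳ; ∧-idem to ·-idem
    ; ∧-zeroʳ to ·-zeroʳ; ∨-zeroˡ to +-zeroˡ)
  open SetoidReasoning setoid

  private
    val : Carrier → Carrier → ℕ → Carrier
    val x y 0 = x
    val x y _ = y

    ≈𝟏⇒≈⊤ : ∀ {x} → (∀ y → x ≈ y + - y) → x ≈ ⊤
    ≈𝟏⇒≈⊤ p = p (d o o)

  complement-unique : ∀ {x y} → x + y ≈ ⊤ → x · y ≈ ⊥ → - x ≈ y
  complement-unique {x} {y} x+y≈⊤ x·y≈⊥ = begin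
    - x                 ≈⟨ ·-identityʳ _ ⟨
    - x · ⊤             ≈⟨ ·-cong ≈-refl x+y≈⊤ ⟨
    - x · (x + y)       ≈⟨ ·-distribˡ-+ _ _ _ ⟩
    - x · x + - x · y   ≈⟨ +-cong (·-complˡ x) ≈-refl ⟩
    ⊥ + - x · y         ≈⟨ +-cong x·y≈⊥ ≈-refl ⟨
    x · y + - x · y     ≈⟨ ·-distribʳ-+ _ _ _ ⟨
    (x + - x) · y       ≈⟨ ·-cong (+-compl x) ≈-refl ⟩
    ⊤ · y               ≈⟨ ·-identityˡ y ⟩
    y                   ∎

  c-+ : ∀ i x y → c i (x + y) ≈ c i x + c i y
  c-+ i x y = ca _ c-distrib-+ (val x y)

  c-fixed : ∀ i x → Fixed i (c i x)
  c-fixed i x = ≈-sym (ca _ c-idem (val x x))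

  c-swap : ∀ {i j} → i ≢ j → ∀ x → c i (c j x) ≈ c j (c i x)
  c-swap i≢j x = ca _ (c-comm i≢j) (val x x)

  fixed-resp : ∀ {i x y} → x ≈ y → Fixed i x → Fixed i y
  fixed-resp x≈y p = ≈-trans (c-cong _ (≈-sym x≈y)) (≈-trans p x≈y)

  fixed-+ : ∀ {i x y} → Fixed i x → Fixed i y → Fixed i (x + y)
  fixed-+ p q = ≈-trans (c-+ _ _ _) (+-cong p q)

  fixed-neg : ∀ {i x} → Fixed i x → Fixed i (- x)
  fixed-neg {i} {x} p = begin
    c i (- x)      ≈⟨ c-cong i (-‿cong p) ⟨
    c i (- c i x)  ≈⟨ ca _ c-complement (val x x) ⟩
    - c i x        ≈⟨ -‿cong p ⟩
    - x            ∎

  fixed-c : ∀ {i x} j → Fixed i x → Fixed i (c j x)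
  fixed-c {i} {x} j p with i ≟ j
  ... | yes refl = c-fixed i x
  ... | no  i≢j  = ≈-trans (c-swap i≢j x) (c-cong j p)

  fixed-⊤ : ∀ i → Fixed i ⊤
  fixed-⊤ i = ≈-trans (≈-sym (ca _ c-increasing (val ⊤ ⊤))) (+-zeroˡ _)

  fixed-⊥ : ∀ i → Fixed i ⊥
  fixed-⊥ i = fixed-neg (fixed-⊤ i)

  -- For distinct `j` and `k` the transitivity axiom exhibits `d j k` as a value of `c i`; for equal
  -- ones it is the unit.
  fixed-d : ∀ {i j k} → i ≢ j → i ≢ k → Fixed i (d j k)
  fixed-d {i} {j} {k} i≢j i≢k with j ≟ k
  ... | yes refl = fixed-resp (≈-sym (≈𝟏⇒≈⊤ λ y → ca _ d-refl (val y y))) (fixed-⊤ i)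
  ... | no  j≢k  =
    fixed-resp (ca _ (d-trans (≢-sym i≢j) i≢k j≢k) (λ _ → ⊤)) (c-fixed i _)

  fixed-⟦⟧ : ∀ {i ρ} (s : ℕ → List I) → (∀ n → i ∉ s n → Fixed i (ρ n)) →
             ∀ t → i ∉ support s t → Fixed i (⟦ t ⟧ ρ)
  fixed-⟦⟧ s fix (var n)    i∉ = fix n i∉
  fixed-⟦⟧ s fix (t ⊕ u)    i∉ =
    fixed-+ (fixed-⟦⟧ s fix t (i∉ ∘ ∈-++⁺ˡ)) (fixed-⟦⟧ s fix u (i∉ ∘ ∈-++⁺ʳ (support s t)))
  fixed-⟦⟧ s fix (⊖ t)      i∉ = fixed-neg (fixed-⟦⟧ s fix t i∉)
  fixed-⟦⟧ s fix (cyl j t)  i∉ = fixed-c j (fixed-⟦⟧ s fix t (i∉ ∘ there))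
  fixed-⟦⟧ s fix (diag j k) i∉ = fixed-d (i∉ ∘ here) (i∉ ∘ there ∘ here)

  -- Monotonicity of `c i` at x ≤ y, with `y` its own cylindrification. The order is encoded as
  -- `x · y ≈ x`.
  c-below : ∀ {i x y} → x · y ≈ x → Fixed i y → c i x · y ≈ c i x
  c-below {i} {x} {y} x≤y p = begin
    c i x · y            ≈⟨ ·-cong ≈-refl below ⟨
    c i x · (c i x + y)  ≈⟨ ·-absorbs _ _ ⟩
    c i x                ∎
    where
    below : c i x + y ≈ y
    below = begin
      c i x + y      ≈⟨ +-cong ≈-refl p ⟨
      c i x + c i y  ≈⟨ c-+ i x y ⟨
      c i (x + y)    ≈⟨ c-cong i (+-comm′ _ _) ⟩
      c i (y + x)    ≈⟨ c-cong i (+-cong ≈-refl (≈-trans (·-comm′ _ _) x≤y)) ⟨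
      c i (y + y · x) ≈⟨ c-cong i (+-absorbs _ _) ⟩
      c i y          ≈⟨ p ⟩
      y              ∎

  ·-below : ∀ x y → (x · y) · y ≈ x · y
  ·-below x y = ≈-trans (·-assoc′ _ _ _)
    (·-cong ≈-refl (·-idem y))

  -- Split x into its parts below and above the complement of y.
  c-·-fixed : ∀ {i x y} → Fixed i y → c i (x · y) ≈ c i x · y
  c-·-fixed {i} {x} {y} p = ≈-sym (begin
    c i x · y                            ≈⟨ ·-cong (c-cong i split) ≈-refl ⟩
    c i (x · y + x · - y) · y            ≈⟨ ·-cong (c-+ i _ _) ≈-refl ⟩
    (c i (x · y) + c i (x · - y)) · y    ≈⟨ ·-distribʳ-+ _ _ _ ⟩
    c i (x · y) · y + c i (x · - y) · y  ≈⟨ +-cong (c-below (·-below x y) p) disjoint ⟩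
    c i (x · y) + ⊥                      ≈⟨ +-identityʳ _ ⟩
    c i (x · y)                          ∎)
    where
    split : x ≈ x · y + x · - y
    split = begin
      x                ≈⟨ ·-identityʳ x ⟨
      x · ⊤            ≈⟨ ·-cong ≈-refl (+-compl y) ⟨
      x · (y + - y)    ≈⟨ ·-distribˡ-+ _ _ _ ⟩
      x · y + x · - y  ∎
    disjoint : c i (x · - y) · y ≈ ⊥
    disjoint = begin
      c i (x · - y) · y          ≈⟨ ·-cong (c-below (·-below x (- y)) (fixed-neg p)) ≈-refl ⟨
      (c i (x · - y) · - y) · y  ≈⟨ ·-assoc′ _ _ _ ⟩
      c i (x · - y) · (- y · y)  ≈⟨ ·-cong ≈-refl (·-complˡ y) ⟩
      c i (x · - y) · ⊥          ≈⟨ ·-zeroʳ _ ⟩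
      ⊥                          ∎

  -- The substitution operators.

  module Substitution (i j : I) (i≢j : i ≢ j) where

    s : Carrier → Carrier
    s x = c i (d i j · x)

    s-fixed : ∀ x → Fixed i (s x)
    s-fixed x = c-fixed i _

    s-cong : ∀ {x y} → x ≈ y → s x ≈ s y
    s-cong x≈y = c-cong i (·-cong ≈-refl x≈y)

    c-d≈⊤ : c i (d i j) ≈ ⊤
    c-d≈⊤ = ≈𝟏⇒≈⊤ λ y → ca _ (c-d i≢j) (val y y)

    s-+ : ∀ x y → s (x + y) ≈ s x + s y
    s-+ x y = ≈-trans (c-cong i (·-distribˡ-+ _ _ _)) (c-+ i _ _)

    s-id : ∀ {x} → Fixed i x → s x ≈ x
    s-id {x} p = begin
      c i (d i j · x)  ≈⟨ c-·-fixed p ⟩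
      c i (d i j) · x  ≈⟨ ·-cong c-d≈⊤ ≈-refl ⟩
      ⊤ · x            ≈⟨ ·-identityˡ x ⟩
      x                ∎

    -- The join of `s x` and `s (- x)` is `s ⊤`, hence `⊤`. For the meet, `s (- x)` is fixed by
    -- `c i` and so moves under the outer `c i`, where it meets `d i j` in the same element as
    -- `- x`; what remains is `c i ⊥`.
    s-- : ∀ x → - s x ≈ s (- x)
    s-- x = complement-unique total disjoint
      where
      total : s x + s (- x) ≈ ⊤
      total = begin
        s x + s (- x)    ≈⟨ s-+ x (- x) ⟨
        s (x + - x)      ≈⟨ s-cong (+-compl x) ⟩
        s ⊤              ≈⟨ s-id (fixed-⊤ i) ⟩
        ⊤                ∎
      disjoint : s x · s (- x) ≈ ⊥
      disjoint = begin
        s x · s (- x)                ≈⟨ c-·-fixed (s-fixed _) ⟨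
        c i ((d i j · x) · s (- x))  ≈⟨ c-cong i (·-cong (·-comm′ _ _) ≈-refl) ⟩
        c i ((x · d i j) · s (- x))  ≈⟨ c-cong i (·-assoc′ _ _ _) ⟩
        c i (x · (d i j · s (- x)))  ≈⟨ c-cong i (·-cong ≈-refl (ca _ (d-c i≢j) (val (- x) x))) ⟩
        c i (x · (d i j · - x))      ≈⟨ c-cong i (·-cong ≈-refl (·-comm′ _ _)) ⟩
        c i (x · (- x · d i j))      ≈⟨ c-cong i (·-assoc′ _ _ _) ⟨
        c i ((x · - x) · d i j)      ≈⟨ c-cong i (·-cong (·-compl x) ≈-refl) ⟩
        c i (⊥ · d i j)              ≈⟨ c-cong i (·-comm′ _ _) ⟩
        c i (d i j · ⊥)              ≈⟨ c-cong i (·-zeroʳ _) ⟩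
        c i ⊥                        ≈⟨ fixed-⊥ i ⟩
        ⊥                            ∎

    -- As `k` differs from `i` and `j`, the diagonal `d i j` is fixed by `c k` and passes under it;
    -- then `c i` and `c k` commute.
    s-c : ∀ {k} → k ≢ i → k ≢ j → ∀ x → s (c k x) ≈ c k (s x)
    s-c {k} k≢i k≢j x = begin
      c i (d i j · c k x)  ≈⟨ c-cong i (·-comm′ _ _) ⟩
      c i (c k x · d i j)  ≈⟨ c-cong i (c-·-fixed (fixed-d k≢i k≢j)) ⟨
      c i (c k (x · d i j)) ≈⟨ c-swap (≢-sym k≢i) _ ⟩
      c k (c i (x · d i j)) ≈⟨ c-cong k (c-cong i (·-comm′ _ _)) ⟩
      c k (c i (d i j · x)) ∎

    s-⟦⟧ : ∀ ρ t → ¬ (i occursInTerm t) → ¬ (j occursInTerm t) →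
           s (⟦ t ⟧ ρ) ≈ ⟦ t ⟧ (s ∘ ρ)
    s-⟦⟧ ρ (var n)    i∉ j∉ = ≈-refl
    s-⟦⟧ ρ (t ⊕ u)    i∉ j∉ = ≈-trans (s-+ _ _)
      (+-cong (s-⟦⟧ ρ t (i∉ ∘ in-⊕ˡ) (j∉ ∘ in-⊕ˡ)) (s-⟦⟧ ρ u (i∉ ∘ in-⊕ʳ) (j∉ ∘ in-⊕ʳ)))
    s-⟦⟧ ρ (⊖ t)      i∉ j∉ =
      ≈-trans (≈-sym (s-- _)) (-‿cong (s-⟦⟧ ρ t (i∉ ∘ in-⊖) (j∉ ∘ in-⊖)))
    s-⟦⟧ ρ (cyl k t)  i∉ j∉ =
      ≈-trans (s-c (λ { refl → i∉ at-cyl }) (λ { refl → j∉ at-cyl }) _)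
              (c-cong k (s-⟦⟧ ρ t (i∉ ∘ in-cyl) (j∉ ∘ in-cyl)))
    s-⟦⟧ ρ (diag k l) i∉ j∉ =
      s-id (fixed-d (λ { refl → i∉ at-diagˡ }) (λ { refl → i∉ at-diagʳ }))

  open Substitution using (s; s-id)

  -- Below `d i j` the elements `s x` and `x` agree, so the outer substitution may be applied to `x`
  -- itself, which it leaves alone because `c j` fixes `x`.
  s-inverse : ∀ {i j} (i≢j : i ≢ j) {x} → Fixed j x → s j i (≢-sym i≢j) (s i j i≢j x) ≈ x
  s-inverse {i} {j} i≢j {x} p = begin
    c j (d j i · c i (d i j · x))  ≈⟨ c-cong j (·-cong d-swap ≈-refl) ⟩
    c j (d i j · c i (d i j · x))  ≈⟨ c-cong j (ca _ (d-c i≢j) (val x x)) ⟩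
    c j (d i j · x)                ≈⟨ c-cong j (·-cong d-swap ≈-refl) ⟨
    c j (d j i · x)                ≈⟨ s-id j i (≢-sym i≢j) p ⟩
    x                              ∎
    where
    d-swap : d j i ≈ d i j
    d-swap = ca _ (d-sym (≢-sym i≢j)) (val x x)

  -- Iterated cylindrifications.

  fixed-cyls : ∀ {i ρ} Δ t → Fixed i (⟦ t ⟧ ρ) → Fixed i (⟦ cyls Δ t ⟧ ρ)
  fixed-cyls []      t p = p
  fixed-cyls (j ∷ Δ) t p = fixed-c j (fixed-cyls Δ t p)

  ∈⇒fixed-cyls : ∀ {i ρ} Δ t → i ∈ₗ Δ → Fixed i (⟦ cyls Δ t ⟧ ρ)
  ∈⇒fixed-cyls (j ∷ Δ) t (here refl) = c-fixed j _
  ∈⇒fixed-cyls (j ∷ Δ) t (there i∈Δ) = fixed-c j (∈⇒fixed-cyls Δ t i∈Δ)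

  cyls-fixed : ∀ {ρ} Δ t → (∀ {i} → i ∈ₗ Δ → Fixed i (⟦ t ⟧ ρ)) → ⟦ cyls Δ t ⟧ ρ ≈ ⟦ t ⟧ ρ
  cyls-fixed []      t p = ≈-refl
  cyls-fixed (j ∷ Δ) t p = ≈-trans (c-cong j (cyls-fixed Δ t (p ∘ there))) (p (here refl))

module _ {a} {I : Set a} (_≟_ : DecidableEquality I) (ι : ℕ ↣ I) where

  private
    o : I
    o = Injection.to ι 0

  -- Equational theories of locally finite classes are inductive.

  Lf-decylindrify : (A : Algebra I) → A ∈ Lf → ∀ e i → ¬ (i occursIn e) →
                    A ⊨ cylindrifyVars i e → A ⊨ e
  Lf-decylindrify A (ca , lf) (t ≋ u) i i∉ A⊨ ρ = begin
    ⟦ t ⟧ ρ             ≈⟨ s-inverse i≢j (fixed t (j∉ ∘ there ∘ ∈-++⁺ˡ)) ⟨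
    s⁻¹ (s (⟦ t ⟧ ρ))   ≈⟨ s⁻¹-cong (s-⟦⟧ ρ t (i∉ ∘ inj₁) (j∉ ∘ there ∘ ∈-++⁺ˡ ∘ occurs⇒∈support supp)) ⟩
    s⁻¹ (⟦ t ⟧ (s ∘ ρ)) ≈⟨ s⁻¹-cong images ⟩
    s⁻¹ (⟦ u ⟧ (s ∘ ρ)) ≈⟨ s⁻¹-cong (s-⟦⟧ ρ u (i∉ ∘ inj₂) (j∉ ∘ there ∘ ∈-++⁺ʳ _ ∘ occurs⇒∈support supp)) ⟨
    s⁻¹ (s (⟦ u ⟧ ρ))   ≈⟨ s-inverse i≢j (fixed u (j∉ ∘ there ∘ ∈-++⁺ʳ _)) ⟩
    ⟦ u ⟧ ρ             ∎
    where
    open Algebra A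
    open Evaluation A
    open Cylindric _≟_ o A ca
    open SetoidReasoning (BooleanAlgebra.setoid booleanAlgebra)

    supp : ℕ → List I
    supp n = proj₁ (lf (ρ n))

    -- The head `i` makes `j` distinct from `i`; the supports keep `j` out of both terms and make
    -- `c j` fix both values.
    choice : ∃[ j ] j ∉ i ∷ support supp t ++ support supp u
    choice = fresh _≟_ ι _

    j : I
    j = proj₁ choice

    j∉ : j ∉ i ∷ support supp t ++ support supp u
    j∉ = proj₂ choice

    i≢j : i ≢ j
    i≢j i≡j = j∉ (here (sym i≡j))

    open Substitution i j i≢j
    open Substitution j i (≢-sym i≢j) using () renaming (s to s⁻¹; s-cong to s⁻¹-cong)

    fixed : ∀ v → j ∉ support supp v → Fixed j (⟦ v ⟧ ρ)
    fixed = fixed-⟦⟧ supp (λ n → proj₂ (lf (ρ n)) j)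

    -- All values of `s ∘ ρ` are fixed by `c i`, so at this valuation the cylindrified equation and
    -- the original one say the same.
    cyl-s : ∀ v → ⟦ substTerm (λ n → cyl i (var n)) v ⟧ (s ∘ ρ) ≈ ⟦ v ⟧ (s ∘ ρ)
    cyl-s v = begin
      ⟦ substTerm (λ n → cyl i (var n)) v ⟧ (s ∘ ρ)  ≡⟨ ⟦substTerm⟧ _ _ v ⟩
      ⟦ v ⟧ (c i ∘ s ∘ ρ)                            ≈⟨ ⟦⟧-cong (λ n → s-fixed (ρ n)) v ⟩
      ⟦ v ⟧ (s ∘ ρ)                                  ∎

    images : ⟦ t ⟧ (s ∘ ρ) ≈ ⟦ u ⟧ (s ∘ ρ)
    images = ≈-trans (≈-sym (cyl-s t)) (≈-trans (A⊨ (s ∘ ρ)) (cyl-s u))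

  Eq-inductive : {E : Pred (Equation I) a} {K : Pred (Algebra I) (suc a)} →
                 K ⊆ Lf → E ≐ Eq K → Inductive E
  Eq-inductive K⊆Lf (E⊆Eq , Eq⊆E) = record
    { containsAxioms     = λ ax → Eq⊆E λ A A∈K → proj₁ (K⊆Lf A∈K) _ ax
    ; semanticallyClosed = λ e → mk⇔
        (λ e∈E A A⊨E → A⊨E e e∈E)
        -- Every member of `K` is itself a model of `E`.
        (λ E⊩e → Eq⊆E λ A A∈K → E⊩e A λ e′ e′∈E → E⊆Eq e′∈E A A∈K)
    ; decylindrify       = λ e i i∉e ce∈E → Eq⊆E λ A A∈K →
        Lf-decylindrify A (K⊆Lf A∈K) e i i∉e (E⊆Eq ce∈E A A∈K)
    }

  -- Inductive sets: removing foreign cylindrifications.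

  module FromInductive {E : Pred (Equation I) a} (E-inductive : Inductive E) where
    open Inductive E-inductive

    ⊩⇒∈ : ∀ {e} → E ⊩ e → e ∈ E
    ⊩⇒∈ = Equivalence.from (semanticallyClosed _)

    model⇒CA : ∀ A → A ⊨* E → A ∈ CA
    model⇒CA A A⊨E e ax = A⊨E e (containsAxioms ax)

    -- The semantic reading of e(c_Δ x) ∈ E.  Unlike the equation itself, it is
    -- visibly monotone in Δ.
    ValidOnFixed : List I → Equation I → Set (suc a)
    ValidOnFixed Δ (t ≋ u) = ∀ A → A ⊨* E →
      ∀ ρ → (∀ n {i} → i ∈ₗ Δ → Fixed A i (ρ n)) → EqualUnder A ρ t u
      where
      open Evaluation using (Fixed; EqualUnder)

    ∈⇒valid : ∀ Δ e → cylindrifyVarsBy Δ e ∈ E → ValidOnFixed Δ e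
    ∈⇒valid Δ (t ≋ u) e∈E A A⊨E ρ fix =
      ≈-trans (≈-sym (value t)) (≈-trans (A⊨E _ e∈E ρ) (value u))
      where
      open Algebra A
      open Evaluation A
      open Cylindric _≟_ o A (model⇒CA A A⊨E)
      open SetoidReasoning (BooleanAlgebra.setoid booleanAlgebra)
      value : ∀ v → ⟦ substTerm (λ n → cyls Δ (var n)) v ⟧ ρ ≈ ⟦ v ⟧ ρ
      value v = begin
        ⟦ substTerm (λ n → cyls Δ (var n)) v ⟧ ρ ≡⟨ ⟦substTerm⟧ _ _ v ⟩
        ⟦ v ⟧ (λ n → ⟦ cyls Δ (var n) ⟧ ρ)       ≈⟨ ⟦⟧-cong (λ n → cyls-fixed Δ (var n) (fix n)) v ⟩
        ⟦ v ⟧ ρ                                  ∎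

    -- The value of c_Δ x is fixed by every index in Δ, inner ones included, because
    -- cylindrifications preserve fixedness. Semantic closure does the rest.
    valid⇒∈ : ∀ Δ e → ValidOnFixed Δ e → cylindrifyVarsBy Δ e ∈ E
    valid⇒∈ Δ (t ≋ u) valid = ⊩⇒∈ consequence
      where
      consequence : E ⊩ cylindrifyVarsBy Δ (t ≋ u)
      consequence A A⊨E ρ =
        subst₂ _≈_ (sym (⟦substTerm⟧ _ ρ t)) (sym (⟦substTerm⟧ _ ρ u))
          (valid A A⊨E (λ n → ⟦ cyls Δ (var n) ⟧ ρ) λ n → ∈⇒fixed-cyls Δ (var n))
        where
        open Algebra A
        open Evaluation A
        open Cylindric _≟_ o A (model⇒CA A A⊨E)

    -- Induction on Δ: `decylindrify` removes the head index from e(c_Δ c_i x), which requires `i`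
    -- to be absent from e(c_Δ x) and not merely from e.
    strip : ∀ Δ e → (∀ {i} → i ∈ₗ Δ → ¬ (i occursIn e)) → ValidOnFixed Δ e → e ∈ E
    strip []      e       Δ∉e valid = ⊩⇒∈ λ A A⊨E ρ → valid A A⊨E ρ λ n ()
    strip (i ∷ Δ) (t ≋ u) Δ∉e valid = strip Δ (t ≋ u) (Δ∉e ∘ there) (reduced (i ∈? Δ))
      where
      open DecMembership _≟_ using (_∈?_)

      reduced : Dec (i ∈ₗ Δ) → ValidOnFixed Δ (t ≋ u)
      -- A repeated index would occur in e(c_Δ x), but its fixedness condition is already among
      -- those for `Δ`.
      reduced (yes i∈Δ) A A⊨E ρ fix =
        valid A A⊨E ρ λ { n (here refl) → fix n i∈Δ ; n (there k∈Δ) → fix n k∈Δ }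
      reduced (no i∉Δ) = ∈⇒valid Δ (t ≋ u) (decylindrify (cylindrifyVarsBy Δ (t ≋ u)) i i∉ (⊩⇒∈ consequence))
        where
        i∉-term : ∀ v → ¬ (i occursInTerm v) → ¬ (i occursInTerm substTerm (λ n → cyls Δ (var n)) v)
        i∉-term v i∉v occ with occurs-substTerm (λ n → cyls Δ (var n)) v occ
        ... | inj₁ i∈v        = i∉v i∈v
        ... | inj₂ (n , occ′) = i∉Δ (occurs-cyls Δ occ′)

        i∉ : ¬ (i occursIn cylindrifyVarsBy Δ (t ≋ u))
        i∉ = [ i∉-term t (Δ∉e (here refl) ∘ inj₁) , i∉-term u (Δ∉e (here refl) ∘ inj₂) ]

        consequence : E ⊩ cylindrifyVars i (cylindrifyVarsBy Δ (t ≋ u))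
        consequence A A⊨E ρ =
          subst₂ _≈_ (sym (value t)) (sym (value u))
            -- Substituting into c_Δ x puts `c i` innermost; the outer cylindrifications keep the
            -- value fixed by `c i`.
            (valid A A⊨E ρ′ λ
              { n (here refl) → fixed-cyls Δ (var n) (c-fixed i (ρ n))
              ; n (there k∈Δ) → ∈⇒fixed-cyls Δ (var n) k∈Δ })
          where
          open Algebra A
          open Evaluation A
          open Cylindric _≟_ o A (model⇒CA A A⊨E)
          ρ′ : ℕ → Carrier
          ρ′ n = ⟦ cyls Δ (var n) ⟧ (c i ∘ ρ)
          value : ∀ v → ⟦ substTerm (λ n → cyl i (var n)) (substTerm (λ n → cyls Δ (var n)) v) ⟧ ρ
                      ≡ ⟦ v ⟧ ρ′
          value v = trans (⟦substTerm⟧ _ ρ (substTerm _ v)) (⟦substTerm⟧ _ (c i ∘ ρ) v)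

    -- The locally finite term model.

    module TermModel (Γ : List I) where

      infix 4 _∼_
      -- Membership in `E` is stored instead of `ValidOnFixed`, which quantifies over algebras and
      -- would be too large for the equality of an `Algebra`.
      record _∼_ (t u : Term I) : Set a where
        constructor modulo
        field
          indices : List I
          foreign : ∀ {i} → i ∈ₗ indices → i ∉ Γ
          member  : cylindrifyVarsBy indices (t ≋ u) ∈ E

      ⊩⇒∼ : ∀ {t u} → E ⊩ (t ≋ u) → t ∼ u
      ⊩⇒∼ {t} {u} E⊩ = modulo [] (λ ()) (valid⇒∈ [] (t ≋ u) λ A A⊨E ρ _ → E⊩ A A⊨E ρ)

      ∼-map : ∀ {t u t′ u′} → (∀ Δ → ValidOnFixed Δ (t ≋ u) → ValidOnFixed Δ (t′ ≋ u′)) →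
              t ∼ u → t′ ∼ u′
      ∼-map {t} {u} {t′} {u′} f (modulo Δ Δ∉Γ e∈E) =
        modulo Δ Δ∉Γ (valid⇒∈ Δ (t′ ≋ u′) (f Δ (∈⇒valid Δ (t ≋ u) e∈E)))

      -- The union of the two index sets serves as a common one, since enlarging the set only
      -- restricts the valuations considered.
      ∼-zip : ∀ {t u t′ u′ t″ u″} →
              (∀ Δ → ValidOnFixed Δ (t ≋ u) → ValidOnFixed Δ (t′ ≋ u′) → ValidOnFixed Δ (t″ ≋ u″)) →
              t ∼ u → t′ ∼ u′ → t″ ∼ u″
      ∼-zip {t} {u} {t′} {u′} {t″} {u″} f (modulo Δ Δ∉Γ e∈E) (modulo Δ′ Δ′∉Γ e′∈E) =
        modulo (Δ ++ Δ′) ([ Δ∉Γ , Δ′∉Γ ] ∘ ∈-++⁻ Δ) (valid⇒∈ (Δ ++ Δ′) (t″ ≋ u″) (f (Δ ++ Δ′)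
          (λ A A⊨E ρ fix → ∈⇒valid Δ (t ≋ u) e∈E A A⊨E ρ λ n → fix n ∘ ∈-++⁺ˡ)
          (λ A A⊨E ρ fix → ∈⇒valid Δ′ (t′ ≋ u′) e′∈E A A⊨E ρ λ n → fix n ∘ ∈-++⁺ʳ Δ)))

      termModel : Algebra I
      termModel = record
        { Carrier       = Term I
        ; _≈_           = _∼_
        ; isEquivalence = record
          { refl  = ⊩⇒∼ λ A _ ρ → IsEquivalence.refl (Algebra.isEquivalence A)
          ; sym   = ∼-map λ Δ p A A⊨E ρ fix →
              IsEquivalence.sym (Algebra.isEquivalence A) (p A A⊨E ρ fix)
          ; trans = ∼-zip λ Δ p q A A⊨E ρ fix →
              IsEquivalence.trans (Algebra.isEquivalence A) (p A A⊨E ρ fix) (q A A⊨E ρ fix)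
          }
        ; _+_           = _⊕_
        ; -_            = ⊖_
        ; c             = cyl
        ; d             = diag
        ; +-cong        = ∼-zip λ Δ p q A A⊨E ρ fix →
            Algebra.+-cong A (p A A⊨E ρ fix) (q A A⊨E ρ fix)
        ; -‿cong        = ∼-map λ Δ p A A⊨E ρ fix → Algebra.-‿cong A (p A A⊨E ρ fix)
        ; c-cong        = λ i → ∼-map λ Δ p A A⊨E ρ fix → Algebra.c-cong A i (p A A⊨E ρ fix)
        }

      open Algebra termModel public using () renaming (⟦_⟧ to ⟦_⟧ₜ)

      ⟦⟧ₜ≡substTerm : ∀ σ t → ⟦ t ⟧ₜ σ ≡ substTerm σ t
      ⟦⟧ₜ≡substTerm σ (var n)    = refl
      ⟦⟧ₜ≡substTerm σ (t ⊕ u)    = cong₂ _⊕_ (⟦⟧ₜ≡substTerm σ t) (⟦⟧ₜ≡substTerm σ u)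
      ⟦⟧ₜ≡substTerm σ (⊖ t)      = cong ⊖_ (⟦⟧ₜ≡substTerm σ t)
      ⟦⟧ₜ≡substTerm σ (cyl i t)  = cong (cyl i) (⟦⟧ₜ≡substTerm σ t)
      ⟦⟧ₜ≡substTerm σ (diag i j) = refl

      module _ (A : Algebra I) where
        open Algebra A
        ⟦⟦⟧ₜ⟧ : ∀ σ ρ t → ⟦ ⟦ t ⟧ₜ σ ⟧ ρ ≡ ⟦ t ⟧ (λ n → ⟦ σ n ⟧ ρ)
        ⟦⟦⟧ₜ⟧ σ ρ t = trans (cong (λ v → ⟦ v ⟧ ρ) (⟦⟧ₜ≡substTerm σ t)) (Evaluation.⟦substTerm⟧ A σ ρ t)

      -- Evaluation in the term model is substitution, and substitution instances of members of `E`
      -- follow from `E`; the empty index set suffices.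
      termModel⊨E : termModel ⊨* E
      termModel⊨E (t ≋ u) e∈E σ = ⊩⇒∼ λ A A⊨E ρ →
        subst₂ (Algebra._≈_ A) (sym (⟦⟦⟧ₜ⟧ A σ ρ t)) (sym (⟦⟦⟧ₜ⟧ A σ ρ u)) (A⊨E _ e∈E _)

      -- For `i` outside `Γ` and `t`, take the index set to be `i` alone: once `c i` fixes the
      -- variables, it fixes the value of `t`.
      termModel-Lf : termModel ∈ Lf
      termModel-Lf = model⇒CA termModel termModel⊨E , λ t → Γ ++ support (λ _ → []) t , λ i i∉ →
        modulo (i ∷ []) (λ { (here refl) → i∉ ∘ ∈-++⁺ˡ }) (valid⇒∈ (i ∷ []) (cyl i t ≋ t) λ A A⊨E ρ fix →
          Cylindric.fixed-⟦⟧ _≟_ o A (model⇒CA A A⊨E) (λ _ → []) (λ n _ → fix n (here refl))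
            t (i∉ ∘ ∈-++⁺ʳ Γ))

    complete : ∀ e → (∀ A → A ∈ Lf → A ⊨* E → A ⊨ e) → e ∈ E
    complete (t ≋ u) valid = conclude (valid termModel termModel-Lf termModel⊨E var)
      where
      -- `Γ` collects the indices of the equation, so every set witnessing `∼` consists of indices
      -- that `strip` can remove.
      open TermModel (support (λ _ → []) t ++ support (λ _ → []) u)

      conclude : ⟦ t ⟧ₜ var ∼ ⟦ u ⟧ₜ var → (t ≋ u) ∈ E
      conclude (modulo Δ Δ∉Γ e∈E) = strip Δ (t ≋ u)
        (λ i∈Δ → [ Δ∉Γ i∈Δ ∘ ∈-++⁺ˡ ∘ occurs⇒∈support _
                 , Δ∉Γ i∈Δ ∘ ∈-++⁺ʳ _ ∘ occurs⇒∈support _ ])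
        -- Evaluating at `var` gives back each term up to a propositional equality, which is removed
        -- here.
        (λ A A⊨E ρ fix → subst₂ (Algebra._≈_ A) (⟦⟦⟧ₜ⟧ A var ρ t) (⟦⟦⟧ₜ⟧ A var ρ u)
          (∈⇒valid Δ (⟦ t ⟧ₜ var ≋ ⟦ u ⟧ₜ var) e∈E A A⊨E ρ fix))

theorem4p6 : ∀ {a} (α : Ordinal a) → Infinite α →
    (E : Pred (Equation (Index α)) a) →
    Inductive E ⇔ (∃[ K ] K ⊆ Lf × E ≐ Eq {ℓ = suc a} K)
theorem4p6 {a} α ι E = mk⇔ forward λ (_ , K⊆Lf , E≐Eq) → Eq-inductive _≟_ ι K⊆Lf E≐Eq
  where
  open IsStrictTotalOrder (Ordinal.isStrictTotalOrder α) using (_≟_)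

  -- The largest possible choice: all locally finite models of `E`. `Lift` adjusts the universe
  -- level.
  K : Pred (Algebra (Index α)) (suc a)
  K A = Lift (suc a) (A ∈ Lf × A ⊨* E)

  forward : Inductive E → ∃[ K ] K ⊆ Lf × E ≐ Eq {ℓ = suc a} K
  forward ind = K , (λ A∈K → proj₁ (lower A∈K))
    , (λ e∈E A A∈K → proj₂ (lower A∈K) _ e∈E)
    , (λ {e} valid → FromInductive.complete _≟_ ι ind e λ A lf A⊨E → valid A (lift (lf , A⊨E)))
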